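{- Let $n\ge2r\ge4$. If $k>n-r$, then there is no graph $H$ with $\mathsf{TJ}_k(H)\cong J(n,r)$; that is, $k\notin\mathcal{K}^{\mathsf{TJ}}(J(n,r))$.
   Context: All graphs are finite, simple, undirected. A $k$-clique of a graph $H$ is a set of $k$ pairwise adjacent vertices. For a graph $H$ and integer $k\ge1$, the Token Jumping graph $\mathsf{TJ}_k(H)$ has as vertices the $k$-cliques of $H$, and two $k$-cliques $A,B$ are adjacent iff $|A\cap B|=k-1$. $\mathcal{K}^{\mathsf{TJ}}(G)=\{k\ge1:\ \exists H,\ \mathsf{TJ}_k(H)\cong G\}$. The Johnson graph $J(n,r)$ has as vertices the $r$-subsets of $\{1,\dots,n\}$, two being adjacent iff their intersection has size $r-1$. -}

module Defs where

open import Data.Fin.Base using (Fin)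
open import Data.Fin.Subset using (Subset; _∈_; _∩_; ∣_∣)
open import Data.Fin.Subset.Properties using (∩-comm; ∩-idem)
open import Data.Nat.Base using (ℕ; suc; _≤_)
open import Data.Nat.Properties using (_≟_; 1+n≢n)
open import Data.Product.Base using (Σ; Σ-syntax; ∃-syntax; _×_; _,_; proj₁)
open import Function.Bundles using (Inverse; _⇔_)
open import Level using (0ℓ) renaming (suc to ℓ-suc)
open import Relation.Binary.Bundles using (Setoid)
open import Relation.Binary.Core using (Rel)
open import Relation.Binary.Definitions using (Symmetric; Irreflexive; Decidable; _Respects₂_)
open import Relation.Binary.PropositionalEquality
  using (_≡_; _≢_; refl; sym; trans; cong; setoid)
import Relation.Binary.Construct.On as On
open import Relation.Unary using (Pred)

-- The vertices form a setoid so that a vertex may be a set bundled with a proof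
-- (a k-clique, an r-subset) and still be determined by the set alone.
record Graph (V : Setoid 0ℓ 0ℓ) : Set₁ where
  open Setoid V using (Carrier; _≈_)
  infix 4 _~_ _~?_
  field
    _~_      : Rel Carrier 0ℓ
    ~-sym    : Symmetric _~_
    ~-irrefl : Irreflexive _≈_ _~_
    ~-resp-≈ : _~_ Respects₂ _≈_
    _~?_     : Decidable _~_

-- A finite graph, with its vertices labelled by Fin m.
FinGraph : ℕ → Set₁
FinGraph m = Graph (setoid (Fin m))

infix 4 _≅_
record _≅_ {V W : Setoid 0ℓ 0ℓ} (G : Graph V) (H : Graph W) : Set where
  private
    module G = Graph G
    module H = Graph H
  field
    vertices : Inverse V W
  open Inverse vertices public
  field
    adjacency : ∀ x y → (x G.~ y) ⇔ (to x H.~ to y)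

-- Sets A, B adjacent iff ∣A ∩ B∣ = s − 1, written without truncated subtraction.
Exchange : ∀ {m} → ℕ → Rel (Subset m) 0ℓ
Exchange s A B = suc ∣ A ∩ B ∣ ≡ s

-- The graph of one-element exchanges on the s-subsets satisfying P.
exchangeGraph : ∀ {m} (s : ℕ) (P : Pred (Subset m) 0ℓ) →
                (∀ A → P A → ∣ A ∣ ≡ s) →
                Graph (On.setoid {B = Σ (Subset m) P} (setoid (Subset m)) proj₁)
exchangeGraph s P size = record
  { _~_      = λ (A , _) (B , _) → Exchange s A B
  ; ~-sym    = λ { {A , _} {B , _} e → trans (cong (λ C → suc ∣ C ∣) (∩-comm B A)) e }
  ; ~-irrefl = λ { {A , p} {.A , _} refl e →
      1+n≢n (trans (trans (cong (λ C → suc ∣ C ∣) (sym (∩-idem A))) e) (sym (size A p))) }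
  ; ~-resp-≈ = (λ { {A , _} refl e → e }) , (λ { {A , _} refl e → e })
  ; _~?_     = λ (A , _) (B , _) → suc ∣ A ∩ B ∣ ≟ s
  }

IsClique : ∀ {m} → FinGraph m → ℕ → Pred (Subset m) 0ℓ
IsClique H k A = ∣ A ∣ ≡ k × (∀ i j → i ∈ A → j ∈ A → i ≢ j → i ~ j)
  where open Graph H using (_~_)

CliqueSetoid : ∀ {m} → FinGraph m → ℕ → Setoid 0ℓ 0ℓ
CliqueSetoid {m} H k = On.setoid {B = Σ (Subset m) (IsClique H k)} (setoid (Subset m)) proj₁

TJ : ∀ {m} (k : ℕ) (H : FinGraph m) → Graph (CliqueSetoid H k)
TJ k H = exchangeGraph k (IsClique H k) (λ _ → proj₁)

SubsetSetoid : ℕ → ℕ → Setoid 0ℓ 0ℓ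
SubsetSetoid n r = On.setoid {B = Σ[ A ∈ Subset n ] ∣ A ∣ ≡ r} (setoid (Subset n)) proj₁

J : (n r : ℕ) → Graph (SubsetSetoid n r)
J n r = exchangeGraph r (λ A → ∣ A ∣ ≡ r) (λ _ e → e)

𝒦TJ : {V : Setoid 0ℓ 0ℓ} → Graph V → Pred ℕ (ℓ-suc 0ℓ)
𝒦TJ G k = 1 ≤ k × (∃[ m ] Σ[ H ∈ FinGraph m ] TJ k H ≅ G)

{-# OPTIONS --safe #-}
-- If three pairwise adjacent k-cliques of H do not all contain the intersection
-- of the first two, then their union is a (k+1)-clique S of H, and the k-subsets
-- of S are k + 1 pairwise adjacent vertices of TJ k H.  In J n r, every vertex
-- equal or adjacent to each of I∪{a}, I∪{b}, I∪{c} contains I, and every vertex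
-- equal or adjacent to each of U∖{a}, U∖{b}, U∖{c} lies in U, so a triangle
-- belongs to a clique of at most n ∸ r + 1, respectively r + 1, vertices.  Since
-- k > n ∸ r ≥ r, every triangle of TJ k H ≅ J n r is therefore of the first kind:
-- all vertices adjacent to both A and B contain A ∩ B, hence are equal or adjacent
-- to each other.  But J n r has an edge with two non-adjacent common neighbours.
module Submission where

open import Defs
open import Data.Bool.Base using (true; false)
open import Data.Empty using () renaming (⊥ to Empty)
open import Data.Fin.Base using (Fin; zero; suc)
open import Data.Fin.Patterns using (0F; 3F)
open import Data.Fin.Properties using (_≟_; any?; suc-injective)
open import Data.Fin.Subset
  using (Subset; inside; outside; _∈_; _⊆_; _∩_; _∪_; _-_; ∁; ⁅_⁆; ∣_∣; ⊥)
  renaming (_∉_ to _∉ˢ_)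
open import Data.Fin.Subset.Properties
open import Data.Nat.Base using (ℕ; zero; suc; _+_; _*_; _∸_; _≤_; _<_; z≤n; s≤s; s≤s⁻¹)
open import Data.Nat.Properties
  using (≤-reflexive; ≤-trans; ≤-antisym; ≤-<-trans; <⇒≱; n≤1+n; m≤n+m; m∸n≤m;
         +-∸-assoc; +-identityʳ; ∸-monoˡ-≤; m+n∸m≡n; *-cancelˡ-≤)
open import Data.Product.Base using (Σ-syntax; ∃-syntax; _×_; _,_; proj₁; proj₂)
open import Data.Sum.Base using (_⊎_; inj₁; inj₂)
open import Data.Vec.Base using ([]; _∷_; here; there)
open import Function.Base using (_∘_)
open import Function.Bundles using (Equivalence)
open import Relation.Binary.PropositionalEquality
  using (_≡_; _≢_; refl; sym; trans; cong; subst; subst₂)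
open import Relation.Nullary.Decidable using (yes; no; ¬?; _×-dec_; decidable-stable)
open import Relation.Nullary.Negation.Core using (¬_; contradiction)
open import Relation.Unary using (_∉_)

private
  variable
    m n s : ℕ
    p q : Subset n
    x y : Fin n

-- Cardinalities of finite subsets.

x∉p-x : ∀ (p : Subset n) x → x ∉ˢ p - x
x∉p-x p x x∈ = <⇒≱ (x∈p⇒∣p-x∣<∣p∣ x∈) (≤-reflexive (cong ∣_∣ (sym (p─q─q≡p─q p ⁅ x ⁆))))

∣p∣≤1+∣p-x∣ : ∀ (p : Subset n) x → ∣ p ∣ ≤ suc ∣ p - x ∣
∣p∣≤1+∣p-x∣ (true  ∷ p) zero    = s≤s (≤-reflexive (cong ∣_∣ (sym (p─⊥≡p p))))
∣p∣≤1+∣p-x∣ (false ∷ p) zero    =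
  ≤-trans (≤-reflexive (cong ∣_∣ (sym (p─⊥≡p p)))) (n≤1+n _)
∣p∣≤1+∣p-x∣ (true  ∷ p) (suc x) = s≤s (∣p∣≤1+∣p-x∣ p x)
∣p∣≤1+∣p-x∣ (false ∷ p) (suc x) = ∣p∣≤1+∣p-x∣ p x

⊆⊎∃∉ : (p q : Subset n) → p ⊆ q ⊎ (∃[ x ] x ∈ p × x ∉ˢ q)
⊆⊎∃∉ p q with any? (λ x → (x ∈? p) ×-dec ¬? (x ∈? q))
... | yes w = inj₂ w
... | no ∄  = inj₁ λ {x} x∈p → decidable-stable (x ∈? q) λ x∉q → ∄ (x , x∈p , x∉q)

∣q∣<∣p∣⇒∃∉ : (p q : Subset n) → ∣ q ∣ < ∣ p ∣ → ∃[ x ] x ∈ p × x ∉ˢ q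
∣q∣<∣p∣⇒∃∉ p q lt with ⊆⊎∃∉ p q
... | inj₁ p⊆q = contradiction (p⊆q⇒∣p∣≤∣q∣ p⊆q) (<⇒≱ lt)
... | inj₂ w   = w

p⊆q∧∣q∣≤∣p∣⇒p≡q : p ⊆ q → ∣ q ∣ ≤ ∣ p ∣ → p ≡ q
p⊆q∧∣q∣≤∣p∣⇒p≡q {p = p} {q} p⊆q le with ⊆⊎∃∉ q p
... | inj₁ q⊆p = ⊆-antisym p⊆q q⊆p
... | inj₂ w   = contradiction le (<⇒≱ (p⊂q⇒∣p∣<∣q∣ (p⊆q , w)))

-- By injectivity the remaining images avoid the image of the first element, so the induction
-- continues in `q - f zero here`. The map `f` sees the membership proof because `triangle⇒k<∣T∣`
-- extracts its values from such proofs.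
injection⇒∣p∣≤∣q∣ : (p : Subset m) (q : Subset n) (f : ∀ i → i ∈ p → Fin n) →
                   (∀ i i∈p → f i i∈p ∈ q) →
                   (∀ i j i∈p j∈p → f i i∈p ≡ f j j∈p → i ≡ j) → ∣ p ∣ ≤ ∣ q ∣
injection⇒∣p∣≤∣q∣ []           q f f∈ inj = z≤n
injection⇒∣p∣≤∣q∣ (false ∷ p) q f f∈ inj =
  injection⇒∣p∣≤∣q∣ p q (λ i → f (suc i) ∘ there) (λ i → f∈ (suc i) ∘ there)
    λ i j a b e → suc-injective (inj (suc i) (suc j) (there a) (there b) e)
injection⇒∣p∣≤∣q∣ (true ∷ p)  q f f∈ inj =
  ≤-trans (s≤s (injection⇒∣p∣≤∣q∣ p (q - f zero here) (λ i → f (suc i) ∘ there)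
      (λ i i∈p → x∈p∧x≢y⇒x∈p-y (f∈ (suc i) (there i∈p))
        λ e → contradiction (inj (suc i) zero (there i∈p) here e) λ ())
      λ i j a b e → suc-injective (inj (suc i) (suc j) (there a) (there b) e)))
    (x∈p⇒∣p-x∣<∣p∣ (f∈ zero here))

subsetOfSize : ∀ {r n} → r ≤ n → ∃[ p ] ∣_∣ {n} p ≡ r
subsetOfSize {n = n} z≤n = ⊥ , ∣⊥∣≡0 n
subsetOfSize (s≤s r≤n)   = let p , e = subsetOfSize r≤n in inside ∷ p , cong suc e

-- Sets that differ by at most one exchange.

-- p ⊆₁ q: at most one element of p is missing from q.  For sets of the same size,
-- this says that they are equal or differ by a one-element exchange.
infix 4 _⊆₁_
_⊆₁_ : Subset n → Subset n → Set
p ⊆₁ q = ∀ {x y} → x ∈ p → x ∉ˢ q → y ∈ p → y ∉ˢ q → x ≡ y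

-- Two distinct elements missing from `q` would confine `p ∩ q` to `p - x - y`, which has two
-- elements fewer than `p`.
∣p∣≤1+∣p∩q∣⇒p⊆₁q : ∣ p ∣ ≤ suc ∣ p ∩ q ∣ → p ⊆₁ q
∣p∣≤1+∣p∩q∣⇒p⊆₁q {p = p} {q} le {x} {y} x∈p x∉q y∈p y∉q with x ≟ y
... | yes x≡y = x≡y
... | no x≢y  = contradiction le (<⇒≱ (≤-trans (s≤s (s≤s (p⊆q⇒∣p∣≤∣q∣ p∩q⊆)))
                  (≤-trans (s≤s (x∈p⇒∣p-x∣<∣p∣ y∈p-x)) (x∈p⇒∣p-x∣<∣p∣ x∈p))))
  where
  y∈p-x : y ∈ p - x
  y∈p-x = x∈p∧x≢y⇒x∈p-y y∈p (x≢y ∘ sym)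

  p∩q⊆ : p ∩ q ⊆ p - x - y
  p∩q⊆ z∈ = let z∈p , z∈q = x∈p∩q⁻ p q z∈ in
    x∈p∧x≢y⇒x∈p-y (x∈p∧x≢y⇒x∈p-y z∈p λ { refl → x∉q z∈q }) λ { refl → y∉q z∈q }

exchange⇒⊆₁ : ∣ p ∣ ≡ s → Exchange s p q → p ⊆₁ q
exchange⇒⊆₁ ∣p∣≡s e = ∣p∣≤1+∣p∩q∣⇒p⊆₁q (≤-reflexive (trans ∣p∣≡s (sym e)))

exchange-sym : ∀ (p q : Subset n) → Exchange s p q → Exchange s q p
exchange-sym p q e = trans (cong (suc ∘ ∣_∣) (∩-comm q p)) e

-- An element `x` of `p` outside `q` is the only one, so `p ∩ q` and `p - x` have the same elements.
⊆₁⇒≡⊎exchange : ∣ p ∣ ≡ s → ∣ q ∣ ≡ s → p ⊆₁ q → p ≡ q ⊎ Exchange s p q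
⊆₁⇒≡⊎exchange {p = p} {q = q} ∣p∣≡s ∣q∣≡s p⊆₁q with ⊆⊎∃∉ p q
... | inj₁ p⊆q = inj₁ (p⊆q∧∣q∣≤∣p∣⇒p≡q p⊆q (≤-reflexive (trans ∣q∣≡s (sym ∣p∣≡s))))
... | inj₂ (x , x∈p , x∉q) = inj₂ (trans (≤-antisym
        (≤-trans (s≤s (p⊆q⇒∣p∣≤∣q∣ p∩q⊆p-x)) (x∈p⇒∣p-x∣<∣p∣ x∈p))
        (≤-trans (∣p∣≤1+∣p-x∣ p x) (s≤s (p⊆q⇒∣p∣≤∣q∣ p-x⊆p∩q)))) ∣p∣≡s)
  where
  p∩q⊆p-x : p ∩ q ⊆ p - x
  p∩q⊆p-x z∈ = let z∈p , z∈q = x∈p∩q⁻ p q z∈ in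
    x∈p∧x≢y⇒x∈p-y z∈p λ { refl → x∉q z∈q }

  p-x⊆p∩q : p - x ⊆ p ∩ q
  p-x⊆p∩q {z} z∈ with z ∈? q
  ... | yes z∈q = x∈p∩q⁺ (p─q⊆p p ⁅ x ⁆ z∈ , z∈q)
  ... | no z∉q  = contradiction
    (subst (_∈ p - x) (p⊆₁q (p─q⊆p p ⁅ x ⁆ z∈) z∉q x∈p x∉q) z∈) (x∉p-x p x)

superset⊆₁ : p ⊆ q → ∣ q ∣ ≡ suc ∣ p ∣ → q ⊆₁ p
superset⊆₁ {p = p} {q} p⊆q e = ∣p∣≤1+∣p∩q∣⇒p⊆₁q (≤-trans (≤-reflexive e)
  (s≤s (p⊆q⇒∣p∣≤∣q∣ λ x∈p → x∈p∩q⁺ (p⊆q x∈p , x∈p))))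

infix 4 _≈₁_
-- Both directions are carried so that `triangle⇒⊆` and `triangle⇒⊇` can argue without
-- cardinalities.
_≈₁_ : Subset n → Subset n → Set
p ≈₁ q = p ⊆₁ q × q ⊆₁ p

⊆⇒⊆₁ : p ⊆ q → p ⊆₁ q
⊆⇒⊆₁ p⊆q x∈p x∉q = contradiction (p⊆q x∈p) x∉q

exchange⇒∃∉ : ∀ (p q : Subset n) → ∣ p ∣ ≡ s → Exchange s p q → ∃[ x ] x ∈ p × x ∉ˢ q
exchange⇒∃∉ p q ∣p∣≡s e =
  let x , x∈p , x∉p∩q = ∣q∣<∣p∣⇒∃∉ p (p ∩ q) (≤-reflexive (trans e (sym ∣p∣≡s)))
  in x , x∈p , λ x∈q → x∉p∩q (x∈p∩q⁺ (x∈p , x∈q))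

exchange⇒∣p∪q∣ : ∀ (p q : Subset n) → ∣ p ∣ ≡ s → ∣ q ∣ ≡ s → Exchange s p q → ∣ p ∪ q ∣ ≡ suc s
exchange⇒∣p∪q∣ p q ∣p∣≡s refl e with exchange⇒∃∉ p q ∣p∣≡s e
... | a , a∈p , a∉q = ≤-antisym
  (≤-trans (∣p∣≤1+∣p-x∣ (p ∪ q) a) (s≤s (p⊆q⇒∣p∣≤∣q∣ p∪q-a⊆q)))
  (p⊂q⇒∣p∣<∣q∣ (q⊆p∪q p q , a , p⊆p∪q q a∈p , a∉q))
  where
  p∪q-a⊆q : p ∪ q - a ⊆ q
  p∪q-a⊆q {x} x∈ with x ∈? q | x∈p∪q⁻ p q (p─q⊆p (p ∪ q) ⁅ a ⁆ x∈)
  ... | yes x∈q | _        = x∈q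
  ... | no _    | inj₂ x∈q = x∈q
  ... | no x∉q  | inj₁ x∈p = contradiction
    (subst (_∈ p ∪ q - a) (exchange⇒⊆₁ ∣p∣≡s e x∈p x∉q a∈p a∉q) x∈) (x∉p-x (p ∪ q) a)

-- Closed neighbourhoods of triangles in the Johnson graph.

-- If `e` missed some `z` of `p`, then `z` would be all that `v` and `w` lose, so `e` would contain
-- both `x` and `y`, two elements outside `u`.
triangle⇒⊆ : ∀ {u v w : Subset n} → p ⊆ u → p ⊆ v → p ⊆ w →
             x ∈ v → y ∈ w → x ∉ˢ u → y ∉ˢ u → x ≢ y →
             ∀ {e} → e ≈₁ u → e ≈₁ v → e ≈₁ w → p ⊆ e
triangle⇒⊆ {x = x} {y} p⊆u p⊆v p⊆w x∈v y∈w x∉u y∉u x≢y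
  {e} (e⊆₁u , _) (_ , v⊆₁e) (_ , w⊆₁e) {z} z∈p
  with z ∈? e | x ∈? e | y ∈? e
... | yes z∈e | _       | _       = z∈e
... | no z∉e  | no x∉e  | _       =
  contradiction (subst (_∈ _) (v⊆₁e (p⊆v z∈p) z∉e x∈v x∉e) (p⊆u z∈p)) x∉u
... | no z∉e  | yes _   | no y∉e  =
  contradiction (subst (_∈ _) (w⊆₁e (p⊆w z∈p) z∉e y∈w y∉e) (p⊆u z∈p)) y∉u
... | no _    | yes x∈e | yes y∈e = contradiction (e⊆₁u x∈e x∉u y∈e y∉u) x≢y

-- Dually, an element of `e` outside `p` would be the only one that `e` has beyond `v` and beyond
-- `w`, so `e` would miss both `x` and `y`, two elements of `u`.
triangle⇒⊇ : ∀ {u v w : Subset n} → u ⊆ p → v ⊆ p → w ⊆ p →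
             x ∈ p → y ∈ p → x ∈ u → y ∈ u → x ∉ˢ v → y ∉ˢ w → x ≢ y →
             ∀ {e} → e ≈₁ u → e ≈₁ v → e ≈₁ w → e ⊆ p
triangle⇒⊇ {p = p} {x} {y} u⊆p v⊆p w⊆p x∈p y∈p x∈u y∈u x∉v y∉w x≢y
  {e} (_ , u⊆₁e) (e⊆₁v , _) (e⊆₁w , _) {z} z∈e
  with z ∈? p | x ∈? e | y ∈? e
... | yes z∈p | _       | _       = z∈p
... | no z∉p  | yes x∈e | _       =
  contradiction (subst (_∈ p) (e⊆₁v x∈e x∉v z∈e (z∉p ∘ v⊆p)) x∈p) z∉p
... | no z∉p  | no _    | yes y∈e =
  contradiction (subst (_∈ p) (e⊆₁w y∈e y∉w z∈e (z∉p ∘ w⊆p)) y∈p) z∉p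
... | no _    | no x∉e  | no y∉e  = contradiction (u⊆₁e x∈u x∉e y∈u y∉e) x≢y

p⊆q⇒∃q≡p∪⁅x⁆ : p ⊆ q → ∣ q ∣ ≡ suc ∣ p ∣ → ∃[ x ] x ∈ ∁ p × q ≡ p ∪ ⁅ x ⁆
p⊆q⇒∃q≡p∪⁅x⁆ {p = p} {q} p⊆q e =
  let x , x∈q , x∉p = ∣q∣<∣p∣⇒∃∉ q p (≤-reflexive (sym e))
  in x , x∉p⇒x∈∁p x∉p , ⊆-antisym (q⊆ x∈q x∉p) (⊆q x∈q)
  where
  q⊆ : ∀ {x} → x ∈ q → x ∉ˢ p → q ⊆ p ∪ ⁅ x ⁆
  q⊆ {x} x∈q x∉p {z} z∈q with z ∈? p
  ... | yes z∈p = p⊆p∪q ⁅ x ⁆ z∈p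
  ... | no z∉p  = q⊆p∪q p ⁅ x ⁆
    (subst (_∈ ⁅ x ⁆) (superset⊆₁ p⊆q e x∈q x∉p z∈q z∉p) (x∈⁅x⁆ x))

  ⊆q : ∀ {x} → x ∈ q → p ∪ ⁅ x ⁆ ⊆ q
  ⊆q {x} x∈q z∈ with x∈p∪q⁻ p ⁅ x ⁆ z∈
  ... | inj₁ z∈p = p⊆q z∈p
  ... | inj₂ z∈x = subst (_∈ q) (sym (x∈⁅y⁆⇒x≡y x z∈x)) x∈q

p⊆q⇒∃p≡q-x : p ⊆ q → ∣ q ∣ ≡ suc ∣ p ∣ → ∃[ x ] x ∈ q × p ≡ q - x
p⊆q⇒∃p≡q-x {p = p} {q} p⊆q e =
  let x , x∈q , x∉p = ∣q∣<∣p∣⇒∃∉ q p (≤-reflexive (sym e))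
  in x , x∈q , p⊆q∧∣q∣≤∣p∣⇒p≡q
       (λ z∈p → x∈p∧x≢y⇒x∈p-y (p⊆q z∈p) λ { refl → x∉p z∈p })
       (s≤s⁻¹ (≤-trans (x∈p⇒∣p-x∣<∣p∣ x∈q) (≤-reflexive e)))

-- Triangles of k-cliques.

module _ {m k : ℕ} (H : FinGraph m) where

  open Graph H using (_~_; ~-sym)

  IsClique-remove : ∀ {S : Subset m} {x} → x ∈ S → IsClique H (suc k) S → IsClique H k (S - x)
  IsClique-remove {S} {x} x∈S (∣S∣≡ , adj) =
    ≤-antisym (s≤s⁻¹ (≤-trans (x∈p⇒∣p-x∣<∣p∣ x∈S) (≤-reflexive ∣S∣≡)))
              (s≤s⁻¹ (≤-trans (≤-reflexive (sym ∣S∣≡)) (∣p∣≤1+∣p-x∣ S x))) ,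
    λ i j i∈ j∈ → adj i j (p─q⊆p S ⁅ x ⁆ i∈) (p─q⊆p S ⁅ x ⁆ j∈)

  -- Since `z` is already the one element that `A` and `B` each have outside `C`, whatever belongs
  -- to exactly one of `A` and `B` lies in `C`. The element of `C` outside `A` is then the one that
  -- `B` has there.
  triangle⇒clique : ∀ {A B C : Subset m} → IsClique H k A → IsClique H k B → IsClique H k C →
                    Exchange k A B → Exchange k A C → Exchange k B C →
                    (∃[ z ] z ∈ A ∩ B × z ∉ˢ C) →
                    IsClique H (suc k) (A ∪ B) × C ⊆ A ∪ B
  triangle⇒clique {A} {B} {C} (∣A∣ , adjA) (∣B∣ , adjB) (∣C∣ , adjC) AB AC BC (z , z∈ , z∉C) =
    (exchange⇒∣p∪q∣ A B ∣A∣ ∣B∣ AB , adj) , C⊆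
    where
    z∈A = proj₁ (x∈p∩q⁻ A B z∈)
    z∈B = proj₂ (x∈p∩q⁻ A B z∈)

    A∖B⊆C : ∀ {x} → x ∈ A → x ∉ˢ B → x ∈ C
    A∖B⊆C {x} x∈A x∉B with x ∈? C
    ... | yes x∈C = x∈C
    ... | no x∉C  =
      contradiction (subst (_∈ B) (exchange⇒⊆₁ ∣A∣ AC z∈A z∉C x∈A x∉C) z∈B) x∉B

    B∖A⊆C : ∀ {x} → x ∈ B → x ∉ˢ A → x ∈ C
    B∖A⊆C {x} x∈B x∉A with x ∈? C
    ... | yes x∈C = x∈C
    ... | no x∉C  =
      contradiction (subst (_∈ A) (exchange⇒⊆₁ ∣B∣ BC z∈B z∉C x∈B x∉C) z∈A) x∉A

    C⊆ : C ⊆ A ∪ B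
    C⊆ {x} x∈C with x ∈? A | exchange⇒∃∉ B A ∣B∣ (exchange-sym A B AB)
    ... | yes x∈A | _ = p⊆p∪q B x∈A
    ... | no x∉A  | b , b∈B , b∉A = q⊆p∪q A B (subst (_∈ B)
      (exchange⇒⊆₁ ∣C∣ (exchange-sym A C AC) (B∖A⊆C b∈B b∉A) b∉A x∈C x∉A) b∈B)

    adjAB : ∀ i j → i ∈ A → j ∈ B → i ≢ j → i ~ j
    adjAB i j i∈A j∈B with i ∈? B | j ∈? A
    ... | yes i∈B | _       = adjB i j i∈B j∈B
    ... | no _    | yes j∈A = adjA i j i∈A j∈A
    -- The one pair inside neither `A` nor `B`: its edge comes from `C`.
    ... | no i∉B  | no j∉A  = adjC i j (A∖B⊆C i∈A i∉B) (B∖A⊆C j∈B j∉A)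

    adj : ∀ i j → i ∈ A ∪ B → j ∈ A ∪ B → i ≢ j → i ~ j
    adj i j i∈ j∈ with x∈p∪q⁻ A B i∈ | x∈p∪q⁻ A B j∈
    ... | inj₁ i∈A | inj₁ j∈A = adjA i j i∈A j∈A
    ... | inj₁ i∈A | inj₂ j∈B = adjAB i j i∈A j∈B
    ... | inj₂ i∈B | inj₁ j∈A = ~-sym ∘ adjAB j i j∈A i∈B ∘ (_∘ sym)
    ... | inj₂ i∈B | inj₂ j∈B = adjB i j i∈B j∈B

-- Transfer along the isomorphism.

module _ {m n k r : ℕ} (H : FinGraph m) (iso : TJ k H ≅ J n r) where

  open _≅_ iso

  private
    JVertex = Σ[ A ∈ Subset n ] ∣ A ∣ ≡ r

    cl : JVertex → Subset m
    cl A = proj₁ (from A)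

  to-⊆₁ : ∀ X Y → proj₁ X ⊆₁ proj₁ Y → proj₁ (to X) ⊆₁ proj₁ (to Y)
  to-⊆₁ X Y X⊆₁Y with ⊆₁⇒≡⊎exchange (proj₁ (proj₂ X)) (proj₁ (proj₂ Y)) X⊆₁Y
  ... | inj₁ X≡Y = ⊆⇒⊆₁ (⊆-reflexive (to-cong {X} {Y} X≡Y))
  ... | inj₂ XY  = exchange⇒⊆₁ (proj₂ (to X)) (Equivalence.to (adjacency X Y) XY)

  from-exchange : ∀ A B → Exchange r (proj₁ A) (proj₁ B) → Exchange k (cl A) (cl B)
  from-exchange A B AB = Equivalence.from (adjacency (from A) (from B))
    (subst₂ (Exchange r) (sym (strictlyInverseˡ A)) (sym (strictlyInverseˡ B)) AB)

  from-⊆₁⁻ : ∀ A B → cl A ⊆₁ cl B → proj₁ A ⊆₁ proj₁ B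
  from-⊆₁⁻ A B ⊆₁ = subst₂ _⊆₁_ (strictlyInverseˡ A) (strictlyInverseˡ B)
    (to-⊆₁ (from A) (from B) ⊆₁)

  -- The k + 1 vertices of J n r that correspond to the k-subsets of the clique
  -- A ∪ B are told apart by the elements x of T which determine them through ψ.
  triangle⇒k<∣T∣ : ∀ A B C → Exchange r (proj₁ A) (proj₁ B) → Exchange r (proj₁ A) (proj₁ C) →
    Exchange r (proj₁ B) (proj₁ C) → (∃[ z ] z ∈ cl A ∩ cl B × z ∉ˢ cl C) →
    (T : Subset n) (ψ : Fin n → Subset n) →
    (∀ E → ∣ E ∣ ≡ r → E ≈₁ proj₁ A → E ≈₁ proj₁ B → E ≈₁ proj₁ C → ∃[ x ] x ∈ T × E ≡ ψ x) →
    k < ∣ T ∣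
  triangle⇒k<∣T∣ A B C AB AC BC A∩B⊈C T ψ choose = subst (_≤ ∣ T ∣) (proj₁ S-clique)
    (injection⇒∣p∣≤∣q∣ S T (λ i i∈S → proj₁ (chosen i∈S))
      (λ i i∈S → proj₁ (proj₂ (chosen i∈S))) injective)
    where
    S = cl A ∪ cl B

    top = triangle⇒clique H (proj₂ (from A)) (proj₂ (from B)) (proj₂ (from C))
            (from-exchange A B AB) (from-exchange A C AC) (from-exchange B C BC) A∩B⊈C
    S-clique = proj₁ top

    X : ∀ {i} → i ∈ S → Σ[ X ∈ Subset m ] IsClique H k X
    X {i} i∈S = S - i , IsClique-remove H i∈S S-clique

    -- `S - i` and `cl D` are k-subsets of the (k+1)-set `S`, so each misses at most one element of
    -- the other.
    near : ∀ {i} (i∈S : i ∈ S) D → cl D ⊆ S → proj₁ (to (X i∈S)) ≈₁ proj₁ D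
    near {i} i∈S D D⊆S =
      subst (_ ⊆₁_) (strictlyInverseˡ D)
        (to-⊆₁ (X i∈S) (from D) λ x∈ x∉ y∈ y∉ →
          superset⊆₁ D⊆S (size (from D)) (p─q⊆p S ⁅ i ⁆ x∈) x∉ (p─q⊆p S ⁅ i ⁆ y∈) y∉) ,
      subst (_⊆₁ _) (strictlyInverseˡ D)
        (to-⊆₁ (from D) (X i∈S) λ x∈ x∉ y∈ y∉ →
          superset⊆₁ (p─q⊆p S ⁅ i ⁆) (size (X i∈S)) (D⊆S x∈) x∉ (D⊆S y∈) y∉)
      where
      size : (Y : Σ[ Y ∈ Subset m ] IsClique H k Y) → ∣ S ∣ ≡ suc ∣ proj₁ Y ∣
      size (_ , ∣Y∣≡k , _) = trans (proj₁ S-clique) (cong suc (sym ∣Y∣≡k))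

    chosen : ∀ {i} (i∈S : i ∈ S) → ∃[ x ] x ∈ T × proj₁ (to (X i∈S)) ≡ ψ x
    chosen i∈S = choose (proj₁ (to (X i∈S))) (proj₂ (to (X i∈S)))
      (near i∈S A (p⊆p∪q (cl B))) (near i∈S B (q⊆p∪q (cl A) (cl B))) (near i∈S C (proj₂ top))

    injective : ∀ i j (i∈S : i ∈ S) (j∈S : j ∈ S) →
                proj₁ (chosen i∈S) ≡ proj₁ (chosen j∈S) → i ≡ j
    injective i j i∈S j∈S e with i ≟ j
    ... | yes i≡j = i≡j
    -- Equal labels give equal images under `to`, hence `S - i ≡ S - j`, although only the latter
    -- contains `i`.
    ... | no i≢j  = contradiction
      (subst (i ∈_) (sym S-i≡S-j) (x∈p∧x≢y⇒x∈p-y i∈S i≢j)) (x∉p-x S i)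
      where
      to-≡ : proj₁ (to (X i∈S)) ≡ proj₁ (to (X j∈S))
      to-≡ = trans (proj₂ (proj₂ (chosen i∈S)))
        (trans (cong ψ e) (sym (proj₂ (proj₂ (chosen j∈S)))))

      S-i≡S-j : S - i ≡ S - j
      S-i≡S-j = trans (sym (inverseʳ {X i∈S} {to (X j∈S)} (sym to-≡)))
        (strictlyInverseʳ (X j∈S))

  -- A vertex equal or adjacent to all three is `I` with one element added, and that element of
  -- `∁ I` is its label.
  star⇒k<n∸∣I∣ : ∀ A B C → Exchange r (proj₁ A) (proj₁ B) → Exchange r (proj₁ A) (proj₁ C) →
    Exchange r (proj₁ B) (proj₁ C) → (∃[ z ] z ∈ cl A ∩ cl B × z ∉ˢ cl C) →
    ∀ {I b c} → r ≡ suc ∣ I ∣ → I ⊆ proj₁ A → I ⊆ proj₁ B → I ⊆ proj₁ C →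
    b ∈ proj₁ B → c ∈ proj₁ C → b ∉ˢ proj₁ A → c ∉ˢ proj₁ A → b ≢ c → k < n ∸ ∣ I ∣
  star⇒k<n∸∣I∣ A B C AB AC BC ⊈ {I} r≡ I⊆A I⊆B I⊆C b∈B c∈C b∉A c∉A b≢c =
    subst (k <_) (∣∁p∣≡n∸∣p∣ I) (triangle⇒k<∣T∣ A B C AB AC BC ⊈ (∁ I) (λ x → I ∪ ⁅ x ⁆)
      λ E ∣E∣≡r EA EB EC → p⊆q⇒∃q≡p∪⁅x⁆
        (triangle⇒⊆ I⊆A I⊆B I⊆C b∈B c∈C b∉A c∉A b≢c EA EB EC) (trans ∣E∣≡r r≡))

  -- Here the label is the element of `U` that the vertex omits.
  top⇒k≤r : ∀ A B C → Exchange r (proj₁ A) (proj₁ B) → Exchange r (proj₁ A) (proj₁ C) →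
    Exchange r (proj₁ B) (proj₁ C) → (∃[ z ] z ∈ cl A ∩ cl B × z ∉ˢ cl C) →
    ∀ {U b c} → ∣ U ∣ ≡ suc r → proj₁ A ⊆ U → proj₁ B ⊆ U → proj₁ C ⊆ U →
    b ∈ proj₁ A → c ∈ proj₁ A → b ∉ˢ proj₁ B → c ∉ˢ proj₁ C → b ≢ c → k < suc r
  top⇒k≤r A B C AB AC BC ⊈ {U} ∣U∣≡ A⊆U B⊆U C⊆U b∈A c∈A b∉B c∉C b≢c =
    subst (k <_) ∣U∣≡ (triangle⇒k<∣T∣ A B C AB AC BC ⊈ U (U -_)
      λ E ∣E∣≡r EA EB EC → p⊆q⇒∃p≡q-x
        (triangle⇒⊇ A⊆U B⊆U C⊆U (A⊆U b∈A) (A⊆U c∈A) b∈A c∈A b∉B c∉C b≢c EA EB EC)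
        (trans ∣U∣≡ (cong suc (sym ∣E∣≡r))))

  -- `cl A ∩ cl B` has k - 1 elements, so k-cliques containing it differ by at most one exchange,
  -- and so do their images under `to`.
  star⇒⊆₁ : ∀ A B C D → Exchange r (proj₁ A) (proj₁ B) →
            cl A ∩ cl B ⊆ cl C → cl A ∩ cl B ⊆ cl D → proj₁ C ⊆₁ proj₁ D
  star⇒⊆₁ A B C D AB ⊆C ⊆D = from-⊆₁⁻ C D (∣p∣≤1+∣p∩q∣⇒p⊆₁q
    (≤-trans (≤-reflexive (trans (proj₁ (proj₂ (from C))) (sym (from-exchange A B AB))))
      (s≤s (p⊆q⇒∣p∣≤∣q∣ λ z∈ → x∈p∩q⁺ (⊆C z∈ , ⊆D z∈)))))

-- An edge with two non-adjacent common neighbours.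

¬TJ≅J : ∀ {m n r k} → r ≤ n → 2 + r < k → (2 + n) ∸ r < k → (H : FinGraph m) →
        ¬ (TJ k H ≅ J (4 + n) (2 + r))
¬TJ≅J {m} {n} {r} {k} r≤n r<k n-r<k H iso with subsetOfSize r≤n
... | R , ∣R∣≡r = absurd (⊆⊎∃∉ (cl A ∩ cl B) (cl C)) (⊆⊎∃∉ (cl A ∩ cl B) (cl D))
  where
  open _≅_ iso using (from)

  -- `A`, `B`, `C` share `I`, while `A`, `B`, `D` lie in `U`; `R` only pads to the required size.
  A B C D : Σ[ P ∈ Subset (4 + n) ] ∣ P ∣ ≡ 2 + r
  A = inside  ∷ inside  ∷ outside ∷ outside ∷ R , cong (2 +_) ∣R∣≡r
  B = inside  ∷ outside ∷ inside  ∷ outside ∷ R , cong (2 +_) ∣R∣≡r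
  C = inside  ∷ outside ∷ outside ∷ inside  ∷ R , cong (2 +_) ∣R∣≡r
  D = outside ∷ inside  ∷ inside  ∷ outside ∷ R , cong (2 +_) ∣R∣≡r

  I U : Subset (4 + n)
  I = inside ∷ outside ∷ outside ∷ outside ∷ R
  U = inside ∷ inside  ∷ inside  ∷ outside ∷ R

  cl : Σ[ P ∈ Subset (4 + n) ] ∣ P ∣ ≡ 2 + r → Subset m
  cl P = proj₁ (from P)

  -- Each pair used meets in `R` and one of the first four points, so one equation serves all five
  -- adjacencies.
  adj : 2 + ∣ R ∩ R ∣ ≡ 2 + r
  adj = cong (2 +_) (trans (cong ∣_∣ (∩-idem R)) ∣R∣≡r)

  ∣∁I∣ : (4 + n) ∸ ∣ I ∣ ≡ suc ((2 + n) ∸ r)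
  ∣∁I∣ = trans (cong ((3 + n) ∸_) ∣R∣≡r) (+-∸-assoc 1 (≤-trans r≤n (m≤n+m n 2)))

  absurd : cl A ∩ cl B ⊆ cl C ⊎ (∃[ z ] z ∈ cl A ∩ cl B × z ∉ˢ cl C) →
           cl A ∩ cl B ⊆ cl D ⊎ (∃[ z ] z ∈ cl A ∩ cl B × z ∉ˢ cl D) → Empty
  absurd (inj₂ ⊈C) _ = <⇒≱ (subst (k <_) ∣∁I∣
    (star⇒k<n∸∣I∣ H iso A B C adj adj adj ⊈C {I} (cong (2 +_) (sym ∣R∣≡r))
      (s⊆s (out⊆ ⊆-refl)) (s⊆s (s⊆s (out⊆ ⊆-refl))) (s⊆s (s⊆s (s⊆s (out⊆ ⊆-refl))))
      (there (there here)) (there (there (there here)))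
      (λ { (there (there ())) }) (λ { (there (there (there ()))) }) λ ())) n-r<k
  absurd (inj₁ _) (inj₂ ⊈D) = <⇒≱
    (top⇒k≤r H iso A B D adj adj adj ⊈D {U} (cong (3 +_) ∣R∣≡r)
      (s⊆s (s⊆s (out⊆ ⊆-refl))) (s⊆s (out⊆ ⊆-refl)) (out⊆ ⊆-refl)
      (there here) here (λ { (there ()) }) (λ ()) λ ()) r<k
  -- `0F` and `3F` both lie in `C` and not in `D`, one too many for `C ⊆₁ D`.
  absurd (inj₁ ⊆C) (inj₁ ⊆D)
    with () ← star⇒⊆₁ H iso A B C D adj ⊆C ⊆D {0F} {3F}
                here (λ ()) (there (there (there here))) (λ { (there (there (there ()))) })

theorem4p22 : (n r k : ℕ) → 4 ≤ 2 * r → 2 * r ≤ n → n ∸ r < k →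
    ¬ (∃[ m ] Σ[ H ∈ FinGraph m ] TJ k H ≅ J n r) × k ∉ 𝒦TJ (J n r)
theorem4p22 n r k 4≤2r 2r≤n n-r<k = none , none ∘ proj₂
  where
  r≤n-r : r ≤ n ∸ r
  r≤n-r = subst (_≤ n ∸ r) (trans (m+n∸m≡n r (r + 0)) (+-identityʳ r)) (∸-monoˡ-≤ r 2r≤n)

  none : ¬ (∃[ m ] Σ[ H ∈ FinGraph m ] TJ k H ≅ J n r)
  none (m , H , iso) = core n r (*-cancelˡ-≤ 2 4≤2r) r≤n-r n-r<k iso
    where
    core : ∀ n r → 2 ≤ r → r ≤ n ∸ r → n ∸ r < k → ¬ (TJ k H ≅ J n r)
    core (suc (suc n)) (suc (suc r)) (s≤s (s≤s z≤n)) r≤n-r n-r<k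
      -- After the shift this reads `2 + r ≤ n`, which exposes two further successors in `n`.
      with ≤-trans r≤n-r (m∸n≤m n r)
    ... | s≤s (s≤s r≤n) = ¬TJ≅J r≤n (≤-<-trans r≤n-r n-r<k) n-r<k H
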